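{- Let $q$ be a power of the odd prime $p$ and let $f$ be a Dembowski–Ostrom polynomial over $\mathbb F_{q^2}$ such that $x\mapsto f(x)$ is a planar function on $\mathbb F_{q^2}$. Let $\kappa:\mathbb F_{q^2}\to\mathbb F_{q^2}$, $x\mapsto\bar x$, be an additive map with $\kappa(\kappa(x))=x$, $\overline{f(x)}=f(\bar x)$ and $\#\{y:y+\bar y=f(x+\bar x)\}=q$ for all $x\in\mathbb F_{q^2}$, and let $\mathcal U:=\{(x,y):y+\bar y=f(x+\bar x)\}\cup\{(\infty)\}$ be the corresponding unital of $\Pi(f)$. Let $\theta\in\mathbb F_{q^2}^*$ be such that for every $c\in\mathbb F_q$, $\#\{x\in\mathbb F_{q^2}:\theta_1f_0(x)-\theta_0f_1(x)=c\}$ equals $q+1$ if $c\neq0$ and $1$ if $c=0$, and let $\mathcal U_\theta:=\{(x,t\theta):x\in\mathbb F_{q^2},t\in\mathbb F_q\}\cup\{(\infty)\}$. Then $\mathcal U$ and $\mathcal U_\theta$ are not equivalent, i.e.\ no collineation of $\Pi(f)$ maps $\mathcal U_\theta$ onto $\mathcal U$.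
   Context: A Dembowski–Ostrom polynomial over $\mathbb F_{q^2}$ is one of the form $f(x)=\sum_{i,j}a_{ij}x^{p^i+p^j}$ with $a_{ij}\in\mathbb F_{q^2}$. A function $f$ on $\mathbb F_{q^2}$ is planar if $x\mapsto f(x+a)-f(x)$ is a bijection for every $a\neq0$. For planar $f$, $\Pi(f)$ is the projective plane with points $(x,y)\in\mathbb F_{q^2}^2$ and $(a)$ for $a\in\mathbb F_{q^2}\cup\{\infty\}$, lines $L_{a,b}=\{(x,f(x+a)-b):x\in\mathbb F_{q^2}\}\cup\{(a)\}$, $N_a=\{(a,y):y\in\mathbb F_{q^2}\}\cup\{(\infty)\}$ ($a,b\in\mathbb F_{q^2}$), $L_\infty=\{(a):a\in\mathbb F_{q^2}\cup\{\infty\}\}$; a collineation is a bijection of points mapping lines onto lines. A fixed $\xi\in\mathbb F_{q^2}\setminus\mathbb F_q$ is chosen; $\theta=\theta_0+\theta_1\xi$ and $f(x)=f_0(x)+f_1(x)\xi$ with components in $\mathbb F_q$. -}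

module Defs where

open import Level using (0ℓ)
open import Algebra.Apartness.Structures using (IsHeytingField)
open import Algebra.Bundles using (CommutativeRing; Semiring)
import Algebra.Definitions.RawSemiring as RawSemiringDefinitions
open import Data.Fin.Base using (Fin; toℕ)
open import Data.Maybe.Base using (Maybe; just; nothing)
open import Data.Nat.Base as ℕ using (ℕ)
open import Data.Product.Base using (_×_; ∃; ∃-syntax; ∃₂)
open import Function.Bundles using (_↔_; _⇔_; _⤖_; module Bijection)
open import Function.Definitions using (Injective; Bijective)
open import Relation.Binary.PropositionalEquality.Core using (_≡_; _≢_)
open import Relation.Unary using (Pred; _∈_; _∪_; ｛_｝; _≐_)

-- The cardinality of a subset is given by a repetition-free enumeration, so
-- that it does not depend on how many proofs of membership an element has.
HasSize : {A : Set} → Pred A 0ℓ → ℕ → Set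
HasSize {A} S n =
  ∃ λ (e : Fin n → A) → Injective _≡_ _≡_ e × (∀ x → x ∈ S ⇔ (∃[ i ] e i ≡ x))

image : {A B : Set} → (A → B) → Pred A 0ℓ → Pred B 0ℓ
image g S y = ∃[ x ] x ∈ S × g x ≡ y

-- With ≢ as the apartness relation, a Heyting field is an ordinary field:
-- x - y is invertible exactly when x ≢ y (in particular 0# ≢ 1#).
record FiniteField (order : ℕ) : Set₁ where
  infix  8 -_
  infixl 7 _*_
  infixl 6 _+_
  field
    Carrier        : Set
    _+_ _*_        : Carrier → Carrier → Carrier
    -_             : Carrier → Carrier
    0# 1#          : Carrier
    isHeytingField : IsHeytingField _≡_ _≢_ _+_ _*_ -_ 0# 1#
    finite         : Carrier ↔ Fin order

  open IsHeytingField isHeytingField public using (isCommutativeRing)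

  commutativeRing : CommutativeRing 0ℓ 0ℓ
  commutativeRing = record { isCommutativeRing = isCommutativeRing }

  open CommutativeRing commutativeRing public using (_-_; semiring)
  open RawSemiringDefinitions (Semiring.rawSemiring semiring) public using (_^_; sum)

module _ {order : ℕ} (K : FiniteField order) where
  open FiniteField K

  record IsSubfield (F : Pred Carrier 0ℓ) : Set where
    field
      0∈F        : 0# ∈ F
      1∈F        : 1# ∈ F
      +-closed   : ∀ {x y} → x ∈ F → y ∈ F → x + y ∈ F
      neg-closed : ∀ {x} → x ∈ F → - x ∈ F
      *-closed   : ∀ {x y} → x ∈ F → y ∈ F → x * y ∈ F
      inv-closed : ∀ {x y} → x ∈ F → x * y ≡ 1# → y ∈ F

  -- The coefficients a i j of Σ a i j x^(p^i + p^j), for i, j < bound.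
  record DembowskiOstrom : Set where
    field
      bound : ℕ
      coeff : Fin bound → Fin bound → Carrier

  eval : (p : ℕ) → DembowskiOstrom → Carrier → Carrier
  eval p P x =
    sum λ i → sum λ j → coeff i j * x ^ (p ℕ.^ toℕ i ℕ.+ p ℕ.^ toℕ j)
    where open DembowskiOstrom P

  Planar : (Carrier → Carrier) → Set
  Planar f = ∀ a → a ≢ 0# → Bijective _≡_ _≡_ (λ x → f (x + a) - f x)

  data Point : Set where
    affine : Carrier → Carrier → Point
    ideal  : Maybe Carrier → Point

  pattern ∞ = nothing

  data Line : Set where
    L  : Carrier → Carrier → Line
    N  : Carrier → Line
    L∞ : Line

  module Plane (f : Carrier → Carrier) where

    pointsOn : Line → Pred Point 0ℓ
    pointsOn (L a b) = (λ P → ∃[ x ] P ≡ affine x (f (x + a) - b)) ∪ ｛ ideal (just a) ｝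
    pointsOn (N a)   = (λ P → ∃[ y ] P ≡ affine a y) ∪ ｛ ideal ∞ ｝
    pointsOn L∞      = λ P → ∃[ a ] P ≡ ideal a

    IsCollineation : Point ⤖ Point → Set
    IsCollineation φ = ∀ l → ∃[ m ] image (Bijection.to φ) (pointsOn l) ≐ pointsOn m

    Equivalent : Pred Point 0ℓ → Pred Point 0ℓ → Set
    Equivalent S T = ∃[ φ ] IsCollineation φ × image (Bijection.to φ) S ≐ T

    𝒰 : (κ : Carrier → Carrier) → Pred Point 0ℓ
    𝒰 κ = (λ P → ∃₂ λ x y → P ≡ affine x y × y + κ y ≡ f (x + κ x)) ∪ ｛ ideal ∞ ｝

    -- 𝒰[ F , θ ] is 𝒰_θ, with t ranging over the subfield F.
    𝒰[_,_] : (F : Pred Carrier 0ℓ) (θ : Carrier) → Pred Point 0ℓ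
    𝒰[ F , θ ] = (λ P → ∃₂ λ x t → t ∈ F × P ≡ affine x (t * θ)) ∪ ｛ ideal ∞ ｝

{-# OPTIONS --safe #-}
module Submission where

-- The set 𝒰 κ consists of the absolute points of the polarity
-- (x , y) ↔ L (κ x) (κ y), (a) ↔ N (κ a), (∞) ↔ L∞.  On a line L a b the affine
-- points of 𝒰 κ are permuted by the reflection x ↦ 2 κ a - x, because f is
-- quadratic; so a line meeting 𝒰 κ only in Q is the polar line of Q, and the
-- feet of the tangents through any point lie on the polar line of that point.
-- This is an invariant of collineations which 𝒰_θ does not have: if
-- f z ≡ f w modulo F_q θ with z ≠ 0 and w ≠ ± z, then (z , 0), (- z , 0) and
-- (w , f z - f w) are feet of tangents through (0 , f z), and they are collinear
-- only if f w = f z, which planarity excludes.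

open import Defs
open import Level using (0ℓ)
open import Algebra.Apartness.Structures using (module IsHeytingField)
open import Algebra.Bundles using (CommutativeRing)
import Algebra.Solver.Ring as RingSolver
import Algebra.Solver.Ring.AlmostCommutativeRing as ACR
open import Data.Empty using (⊥)
open import Data.Fin.Base using (Fin; zero; suc; toℕ; inject₁; fromℕ)
open import Data.Fin.Permutation using (Permutation)
import Data.Fin.Properties as Fin
open import Data.Integer.Base as ℤ using (ℤ; 0ℤ)
import Data.Integer.Properties as ℤ
open import Data.Maybe.Base as Maybe using (Maybe; just)
open import Data.Nat.Base as ℕ using (ℕ; zero; suc; s≤s; z≤n; _!)
open import Data.Nat.Combinatorics using (_C_; nCn≡1; nCk≡n!/k![n-k]!; k![n∸k]!∣n!)
open import Data.Nat.Divisibility using (_∣_; _∤_; m∣m*n; divides; >⇒∤)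
open import Data.Nat.DivMod using (m/n*n≡m; m≡m%n+[m/n]*n; m%n<n)
open import Data.Nat.Primality using (Prime; prime⇒nonZero; prime⇒nonTrivial; euclidsLemma; prime⇒irreducible)
import Data.Nat.Properties as ℕ
open import Data.Product.Base using (_×_; _,_; ∃-syntax; proj₁)
open import Data.Sum.Base using (_⊎_; inj₁; inj₂; [_,_]′)
open import Function.Bundles using (Inverse; mk↔ₛ′; Equivalence; _⤖_; module Bijection)
open import Function.Construct.Composition using (_↔-∘_)
open import Function.Construct.Symmetry using (↔-sym)
open import Function.Properties.Inverse using (↔⇒↣)
open import Relation.Binary.Definitions using (DecidableEquality; WeaklyDecidable)
open import Relation.Binary.PropositionalEquality as ≡ using (_≡_; _≢_)
open import Relation.Nullary.Decidable using (Dec; yes; no; dec⇒maybe)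
open import Relation.Nullary.Negation using (¬_; contradiction)
open import Relation.Unary using (Pred; _∈_; _∉_; _≐_)

-- The collineation is arbitrary and may move (∞), so the coordinates of the two sets cannot be
-- compared; only incidence can be transported. Hence the polarity is used for `𝒰 κ` alone, and for
-- 𝒰_θ a few explicit tangents suffice.
--
-- These come from the `F_q`-valued map `γ = θ₁ f₀ - θ₀ f₁`, whose fibres are the classes of `f`
-- modulo `F_q θ`. The fibre over 0 has a single element, so `f (x - z)` lies in `F_q θ` only for
-- `x = z`; this makes `L (- z) b` tangent for each `b` in `F_q θ`. A nonzero fibre has `q + 1 ≥ 3`
-- elements, which leaves room for `w` beside `z` and `- z`.
--
-- Odd characteristic enters three times: the reflection on a line has a unique fixed abscissa, the
-- feet over `z` and `- z` are distinct, and collinearity of the three feet yields only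
-- `2 (f w - f z) = 0`.

-- The library's ring solver over an abstract ring cannot compute with
-- coefficients; taking them in ℤ makes cancellation of terms visible to it.
module IntegerCoefficients {c ℓ} (R : CommutativeRing c ℓ) where
  open import Data.Integer.Base using (+_; -[1+_]; _⊖_)
  open CommutativeRing R
  open import Algebra.Properties.Ring ring
  open import Algebra.Properties.AbelianGroup +-abelianGroup using (⁻¹-∙-comm)
  open import Algebra.Properties.Semiring.Mult semiring renaming (_×_ to _⊗_)
  open import Relation.Binary.Reasoning.Setoid setoid

  fromℤ : ℤ → Carrier
  fromℤ (+ n)    = n ⊗ 1#
  fromℤ -[1+ n ] = - (suc n ⊗ 1#)

  private
    shift-difference : ∀ x y → (1# + x) - (1# + y) ≈ x - y
    shift-difference x y = begin
      (1# + x) - (1# + y)     ≈⟨ +-cong (+-comm x 1#) (⁻¹-∙-comm 1# y) ⟨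
      (x + 1#) + (- 1# - y)   ≈⟨ +-assoc x 1# _ ⟩
      x + (1# + (- 1# - y))   ≈⟨ +-congˡ (+-assoc 1# (- 1#) (- y)) ⟨
      x + ((1# - 1#) - y)     ≈⟨ +-congˡ (+-congʳ (-‿inverseʳ 1#)) ⟩
      x + (0# - y)            ≈⟨ +-congˡ (+-identityˡ (- y)) ⟩
      x - y                   ∎

  fromℤ-⊖ : ∀ m n → fromℤ (m ⊖ n) ≈ m ⊗ 1# - n ⊗ 1#
  fromℤ-⊖ m       zero    = sym (trans (+-congˡ -0#≈0#) (+-identityʳ _))
  fromℤ-⊖ zero    (suc n) = sym (+-identityˡ _)
  fromℤ-⊖ (suc m) (suc n) = begin
    fromℤ (suc m ⊖ suc n)     ≡⟨ ≡.cong fromℤ (ℤ.[1+m]⊖[1+n]≡m⊖n m n) ⟩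
    fromℤ (m ⊖ n)             ≈⟨ fromℤ-⊖ m n ⟩
    m ⊗ 1# - n ⊗ 1#           ≈⟨ shift-difference _ _ ⟨
    suc m ⊗ 1# - suc n ⊗ 1#   ∎

  fromℤ-homo-+ : ∀ i j → fromℤ (i ℤ.+ j) ≈ fromℤ i + fromℤ j
  fromℤ-homo-+ (+ m)    (+ n)    = ×-homo-+ 1# m n
  fromℤ-homo-+ (+ m)    -[1+ n ] = fromℤ-⊖ m (suc n)
  fromℤ-homo-+ -[1+ m ] (+ n)    = trans (fromℤ-⊖ n (suc m)) (+-comm _ _)
  fromℤ-homo-+ -[1+ m ] -[1+ n ] = begin
    - (suc (suc (m ℕ.+ n)) ⊗ 1#)     ≡⟨ ≡.cong (λ k → - (suc k ⊗ 1#)) (ℕ.+-suc m n) ⟨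
    - ((suc m ℕ.+ suc n) ⊗ 1#)       ≈⟨ -‿cong (×-homo-+ 1# (suc m) (suc n)) ⟩
    - (suc m ⊗ 1# + suc n ⊗ 1#)      ≈⟨ ⁻¹-∙-comm _ _ ⟨
    - (suc m ⊗ 1#) - suc n ⊗ 1#      ∎

  fromℤ-homo-neg : ∀ i → fromℤ (ℤ.- i) ≈ - fromℤ i
  fromℤ-homo-neg (+ zero)  = sym -0#≈0#
  fromℤ-homo-neg (+ suc n) = refl
  fromℤ-homo-neg -[1+ n ]  = sym (-‿involutive _)

  fromℤ-homo-* : ∀ i j → fromℤ (i ℤ.* j) ≈ fromℤ i * fromℤ j
  fromℤ-homo-* (+ m)    (+ n)    = begin
    fromℤ (+ m ℤ.* + n)   ≡⟨ ≡.cong fromℤ (ℤ.+◃n≡+n (m ℕ.* n)) ⟩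
    (m ℕ.* n) ⊗ 1#        ≈⟨ ×1-homo-* m n ⟩
    m ⊗ 1# * n ⊗ 1#       ∎
  fromℤ-homo-* (+ m)    -[1+ n ] = begin
    fromℤ (+ m ℤ.* -[1+ n ])         ≡⟨ ≡.cong fromℤ (ℤ.-◃n≡-n (m ℕ.* suc n)) ⟩
    fromℤ (ℤ.- (+ (m ℕ.* suc n)))    ≈⟨ fromℤ-homo-neg (+ (m ℕ.* suc n)) ⟩
    - ((m ℕ.* suc n) ⊗ 1#)           ≈⟨ -‿cong (×1-homo-* m (suc n)) ⟩
    - (m ⊗ 1# * suc n ⊗ 1#)          ≈⟨ -‿distribʳ-* _ _ ⟩
    m ⊗ 1# * - (suc n ⊗ 1#)          ∎
  fromℤ-homo-* -[1+ m ] (+ n)    = begin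
    fromℤ (-[1+ m ] ℤ.* + n)         ≡⟨ ≡.cong fromℤ (ℤ.-◃n≡-n (suc m ℕ.* n)) ⟩
    fromℤ (ℤ.- (+ (suc m ℕ.* n)))    ≈⟨ fromℤ-homo-neg (+ (suc m ℕ.* n)) ⟩
    - ((suc m ℕ.* n) ⊗ 1#)           ≈⟨ -‿cong (×1-homo-* (suc m) n) ⟩
    - (suc m ⊗ 1# * n ⊗ 1#)          ≈⟨ -‿distribˡ-* _ _ ⟩
    - (suc m ⊗ 1#) * n ⊗ 1#          ∎
  fromℤ-homo-* -[1+ m ] -[1+ n ] = begin
    (suc m ℕ.* suc n) ⊗ 1#           ≈⟨ ×1-homo-* (suc m) (suc n) ⟩
    suc m ⊗ 1# * suc n ⊗ 1#          ≈⟨ -‿involutive _ ⟨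
    - - (suc m ⊗ 1# * suc n ⊗ 1#)    ≈⟨ -‿cong (-‿distribʳ-* _ _) ⟩
    - (suc m ⊗ 1# * - (suc n ⊗ 1#))  ≈⟨ -‿distribˡ-* _ _ ⟩
    - (suc m ⊗ 1#) * - (suc n ⊗ 1#)  ∎

  private
    morphism : ℤ.+-*-rawRing ACR.-Raw-AlmostCommutative⟶ ACR.fromCommutativeRing R
    morphism = record
      { ⟦_⟧    = fromℤ
      ; +-homo = fromℤ-homo-+
      ; *-homo = fromℤ-homo-*
      ; -‿homo = fromℤ-homo-neg
      ; 0-homo = refl
      ; 1-homo = +-identityʳ 1#
      }

    -- Only a positive answer can be trusted: different integers may have the same image in positive
    -- characteristic, so a failed comparison asserts nothing.
    fromℤ-≟ : WeaklyDecidable (ACR.Induced-equivalence morphism)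
    fromℤ-≟ i j = Maybe.map (λ i≡j → reflexive (≡.cong fromℤ i≡j)) (dec⇒maybe (i ℤ.≟ j))

  open RingSolver ℤ.+-*-rawRing (ACR.fromCommutativeRing R) morphism fromℤ-≟ public

-- Divisibility of binomial coefficients by a prime

prime∤! : ∀ {p} → Prime p → ∀ k → k ℕ.< p → p ∤ k !
prime∤! p-prime zero    _   p∣1  = >⇒∤ (ℕ.nonTrivial⇒n>1 _ {{prime⇒nonTrivial p-prime}}) p∣1
prime∤! p-prime (suc k) k<p p∣k! with euclidsLemma (suc k) (k !) p-prime p∣k!
... | inj₁ p∣k = >⇒∤ k<p p∣k
... | inj₂ p∣! = prime∤! p-prime k (ℕ.<-trans (ℕ.n<1+n k) k<p) p∣!

-- `p` divides `p ! = (p C k) * (k ! * (p ∸ k) !)` but neither of the two smaller factorials, all of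
-- whose factors lie below `p`.
prime∣nCk : ∀ {p} → Prime p → ∀ {k} → 0 ℕ.< k → k ℕ.< p → p ∣ p C k
prime∣nCk {p@(suc p-1)} p-prime {k} 0<k k<p
  with euclidsLemma (p C k) (k ! ℕ.* (p ℕ.∸ k) !) p-prime p∣product
  where
  p∣product : p ∣ (p C k) ℕ.* (k ! ℕ.* (p ℕ.∸ k) !)
  p∣product = ≡.subst (p ∣_)
    (≡.sym (≡.trans (≡.cong (ℕ._* (k ! ℕ.* (p ℕ.∸ k) !)) (nCk≡n!/k![n-k]! (ℕ.<⇒≤ k<p)))
                    (m/n*n≡m {{k ℕ.!* (p ℕ.∸ k) !≢0}} (k![n∸k]!∣n! (ℕ.<⇒≤ k<p)))))
    (m∣m*n (p-1 !))
... | inj₁ p∣C = p∣C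
... | inj₂ p∣d with euclidsLemma (k !) ((p ℕ.∸ k) !) p-prime p∣d
...   | inj₁ p∣k!   = contradiction p∣k! (prime∤! p-prime k k<p)
...   | inj₂ p∣p-k! = contradiction p∣p-k!
        (prime∤! p-prime (p ℕ.∸ k) (ℕ.∸-monoʳ-< 0<k (ℕ.<⇒≤ k<p)))

-- Finite fields: zero divisors, characteristic, Frobenius

module FiniteFieldProperties {order : ℕ} (K : FiniteField order) where
  open FiniteField K
  open CommutativeRing commutativeRing using
    ( ring; commutativeSemiring; +-commutativeMonoid; +-identityˡ; +-identityʳ
    ; *-identityˡ; *-identityʳ; *-comm; zeroˡ; zeroʳ; +-comm; distribʳ )
  open IsHeytingField isHeytingField using (#⇒invertible; invertible⇒#)
  open import Algebra.Properties.Ring ring using (+-cancelʳ)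
  open import Algebra.Properties.Semiring.Mult semiring
    using (×-homo-1; ×-assoc-*; ×1-homo-*)
    renaming (_×_ to _⊗_)
  open import Algebra.Properties.Semiring.Exp semiring using (^-assocʳ)
  open import Algebra.Properties.CommutativeMonoid.Sum +-commutativeMonoid
    using (sum-permute; sum-replicate; ∑-distrib-+; sum-cong-≗; sum-init-last; sum-replicate-zero)
  import Algebra.Properties.CommutativeSemiring.Binomial commutativeSemiring as Binomial
  open IntegerCoefficients commutativeRing using (solve; _:=_; _:+_; _:*_; :-_; _:-_; con)
  open ≡ using (refl; sym; trans; cong; cong₂; subst; module ≡-Reasoning)
  open ≡-Reasoning

  _≟_ : DecidableEquality Carrier
  _≟_ = Fin.inj⇒≟ (↔⇒↣ finite)

  x≢0⇒invertible : ∀ {x} → x ≢ 0# → ∃[ y ] x * y ≡ 1#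
  x≢0⇒invertible {x} x≢0 with y , _ , [x-0]y≡1 ← #⇒invertible x≢0 =
    y , trans (solve 2 (λ x y → x :* y := (x :- con 0ℤ) :* y) refl x y) [x-0]y≡1

  1≢0 : 1# ≢ 0#
  1≢0 = invertible⇒# (1# , 1[1-0]≡1 , trans (*-comm _ _) 1[1-0]≡1)
    where
    1[1-0]≡1 : 1# * (1# - 0#) ≡ 1#
    1[1-0]≡1 = trans (solve 1 (λ x → x :* (x :- con 0ℤ) := x :* x) refl 1#) (*-identityˡ 1#)

  x*y≡0⇒y≡0 : ∀ {x y} → x ≢ 0# → x * y ≡ 0# → y ≡ 0#
  x*y≡0⇒y≡0 {x} {y} x≢0 xy≡0 with z , xz≡1 ← x≢0⇒invertible x≢0 = begin
    y             ≡⟨ *-identityˡ y ⟨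
    1# * y        ≡⟨ cong (_* y) xz≡1 ⟨
    x * z * y     ≡⟨ solve 3 (λ x y z → x :* z :* y := z :* (x :* y)) refl x y z ⟩
    z * (x * y)   ≡⟨ cong (z *_) xy≡0 ⟩
    z * 0#        ≡⟨ zeroʳ z ⟩
    0#            ∎

  x+x≡0⇒x≡0 : 1# + 1# ≢ 0# → ∀ {x} → x + x ≡ 0# → x ≡ 0#
  x+x≡0⇒x≡0 2≢0 {x} x+x≡0 = x*y≡0⇒y≡0 2≢0 (begin
    (1# + 1#) * x       ≡⟨ distribʳ x 1# 1# ⟩
    1# * x + 1# * x     ≡⟨ cong (λ z → z + z) (*-identityˡ x) ⟩
    x + x               ≡⟨ x+x≡0 ⟩
    0#                  ∎)

  -- Translation by 1 permutes the field, so the sum of all elements is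
  -- unchanged when order ⊗ 1# is added to it.
  order×1≡0 : order ⊗ 1# ≡ 0#
  order×1≡0 = sym (+-cancelʳ (sum element) 0# (order ⊗ 1#) (begin
    0# + sum element                          ≡⟨ +-identityˡ _ ⟩
    sum element                               ≡⟨ sum-permute element translation ⟩
    sum (λ i → element (to (1# + element i))) ≡⟨ sum-cong-≗ {order} (λ i → strictlyInverseʳ (1# + element i)) ⟩
    sum (λ i → 1# + element i)                ≡⟨ ∑-distrib-+ (λ _ → 1#) element ⟩
    sum {order} (λ _ → 1#) + sum element      ≡⟨ cong (_+ sum element) (sum-replicate order) ⟩
    order ⊗ 1# + sum element                  ∎))
    where
    open Inverse finite using (to; strictlyInverseʳ) renaming (from to element)
    translation : Permutation order order
    translation = finite ↔-∘ (mk↔ₛ′ (1# +_) (- 1# +_)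
      (λ x → solve 2 (λ e x → e :+ (:- e :+ x) := x) refl 1# x)
      (λ x → solve 2 (λ e x → :- e :+ (e :+ x) := x) refl 1# x)
      ↔-∘ ↔-sym finite)

  -- Without zero divisors, factors `p` can be split off one at a time until one of them vanishes.
  -- Thus the order of the field, a power of `p`, determines its characteristic.
  p^k×1≡0⇒p×1≡0 : ∀ p k → (p ℕ.^ k) ⊗ 1# ≡ 0# → p ⊗ 1# ≡ 0#
  p^k×1≡0⇒p×1≡0 p zero    1×1≡0 = contradiction (trans (sym (×-homo-1 1#)) 1×1≡0) 1≢0
  p^k×1≡0⇒p×1≡0 p (suc k) pp^k×1≡0 with (p ⊗ 1#) ≟ 0#
  ... | yes p×1≡0 = p×1≡0
  ... | no  p×1≢0 = p^k×1≡0⇒p×1≡0 p k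
    (x*y≡0⇒y≡0 p×1≢0 (trans (sym (×1-homo-* p (p ℕ.^ k))) pp^k×1≡0))

  ∣⇒×≡0 : ∀ {p} → p ⊗ 1# ≡ 0# → ∀ {n} → p ∣ n → ∀ x → n ⊗ x ≡ 0#
  ∣⇒×≡0 {p} p×1≡0 (divides k refl) x = begin
    (k ℕ.* p) ⊗ x             ≡⟨ cong ((k ℕ.* p) ⊗_) (*-identityˡ x) ⟨
    (k ℕ.* p) ⊗ (1# * x)      ≡⟨ ×-assoc-* (k ℕ.* p) 1# x ⟨
    (k ℕ.* p) ⊗ 1# * x        ≡⟨ cong (_* x) (×1-homo-* k p) ⟩
    k ⊗ 1# * (p ⊗ 1#) * x     ≡⟨ cong (λ y → k ⊗ 1# * y * x) p×1≡0 ⟩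
    k ⊗ 1# * 0# * x           ≡⟨ cong (_* x) (zeroʳ _) ⟩
    0# * x                    ≡⟨ zeroˡ x ⟩
    0#                        ∎

  -- Parity decides: an even prime is `2`, and for odd `p` the vanishing of `1# + 1#` would turn
  -- `p ⊗ 1#` into `1#`.
  char≢2⇒2≢0 : ∀ {p} → Prime p → p ≢ 2 → p ⊗ 1# ≡ 0# → 1# + 1# ≢ 0#
  char≢2⇒2≢0 {p} p-prime p≢2 p×1≡0 1+1≡0 = go (p ℕ.% 2) (m%n<n p 2) (m≡m%n+[m/n]*n p 2)
    where
    go : ∀ r → r ℕ.< 2 → p ≡ r ℕ.+ p ℕ./ 2 ℕ.* 2 → ⊥
    go 0 _ p≡2k with prime⇒irreducible p-prime (divides (p ℕ./ 2) p≡2k)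
    ... | inj₂ 2≡p = p≢2 (sym 2≡p)
    go 1 _ p≡1+2k = 1≢0 (begin
      1#                                    ≡⟨ +-identityʳ 1# ⟨
      1# + 0#                               ≡⟨ cong (1# +_) (∣⇒×≡0 2×1≡0 (divides (p ℕ./ 2) refl) 1#) ⟨
      (1 ℕ.+ p ℕ./ 2 ℕ.* 2) ⊗ 1#            ≡⟨ cong (_⊗ 1#) p≡1+2k ⟨
      p ⊗ 1#                                ≡⟨ p×1≡0 ⟩
      0#                                    ∎)
      where
      2×1≡0 : 2 ⊗ 1# ≡ 0#
      2×1≡0 = trans (cong (1# +_) (+-identityʳ 1#)) 1+1≡0
    go (suc (suc _)) (s≤s (s≤s ()))

  Additive : (Carrier → Carrier) → Set
  Additive u = ∀ x y → u (x + y) ≡ u x + u y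

  module _ {p : ℕ} (p-prime : Prime p) (p×1≡0 : p ⊗ 1# ≡ 0#) where

    -- In the binomial expansion all coefficients except the two outer ones are multiples of `p`.
    frobenius-additive : Additive (_^ p)
    frobenius-additive x y = go p p-prime p×1≡0
      where
      -- `p` is generalised to `n` so that it can be matched as `suc m`: splitting off the last term
      -- of the sum as well as the first needs this form.
      go : ∀ n → Prime n → n ⊗ 1# ≡ 0# → (x + y) ^ n ≡ x ^ n + y ^ n
      go zero       0-prime = contradiction refl (ℕ.≢-nonZero⁻¹ 0 {{prime⇒nonZero 0-prime}})
      go n@(suc m) n-prime n×1≡0 = begin
        (x + y) ^ n                                ≡⟨ Binomial.theorem n x y ⟩
        sum term                                   ≡⟨⟩
        term zero + sum (λ k → term (suc k))       ≡⟨ cong (term zero +_) (sum-init-last (λ k → term (suc k))) ⟩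
        term zero + (sum (λ k → term (suc (inject₁ k))) + term (suc (fromℕ m)))
          ≡⟨ cong₂ (λ s t → term zero + (s + t))
               (trans (sum-cong-≗ middle) (sum-replicate-zero m)) last ⟩
        term zero + (0# + x ^ n)                   ≡⟨ cong (_+ (0# + x ^ n)) first ⟩
        y ^ n + (0# + x ^ n)                       ≡⟨ cong (y ^ n +_) (+-identityˡ _) ⟩
        y ^ n + x ^ n                              ≡⟨ +-comm _ _ ⟩
        x ^ n + y ^ n                              ∎
        where
        term : Fin (suc n) → Carrier
        term = Binomial.binomialTerm x y n
        first : term zero ≡ y ^ n
        first = trans (+-identityʳ _) (*-identityˡ _)
        middle : ∀ k → term (suc (inject₁ k)) ≡ 0#
        middle k = ∣⇒×≡0 n×1≡0 (prime∣nCk n-prime (s≤s z≤n)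
          (s≤s (subst (ℕ._< m) (sym (Fin.toℕ-inject₁ k)) (Fin.toℕ<n k)))) _
        last : term (suc (fromℕ m)) ≡ x ^ n
        last = begin
          (n C toℕ (fromℕ n)) ⊗ (x ^ toℕ (fromℕ n) * y ^ (n ℕ.∸ toℕ (fromℕ n)))
            ≡⟨ cong (λ k → (n C k) ⊗ (x ^ k * y ^ (n ℕ.∸ k))) (Fin.toℕ-fromℕ n) ⟩
          (n C n) ⊗ (x ^ n * y ^ (n ℕ.∸ n))
            ≡⟨ cong₂ (λ c k → c ⊗ (x ^ n * y ^ k)) (nCn≡1 n) (ℕ.n∸n≡0 n) ⟩
          1 ⊗ (x ^ n * 1#)                   ≡⟨ ×-homo-1 _ ⟩
          x ^ n * 1#                         ≡⟨ *-identityʳ _ ⟩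
          x ^ n                              ∎

    frobenius^-additive : ∀ i → Additive (_^ (p ℕ.^ i))
    frobenius^-additive zero    x y = solve 3 (λ e x y → (x :+ y) :* e := x :* e :+ y :* e) refl 1# x y
    frobenius^-additive (suc i) x y = begin
      (x + y) ^ (p ℕ.* p ℕ.^ i)                       ≡⟨ ^-assocʳ (x + y) p (p ℕ.^ i) ⟨
      ((x + y) ^ p) ^ (p ℕ.^ i)                       ≡⟨ cong (_^ (p ℕ.^ i)) (frobenius-additive x y) ⟩
      (x ^ p + y ^ p) ^ (p ℕ.^ i)                     ≡⟨ frobenius^-additive i (x ^ p) (y ^ p) ⟩
      (x ^ p) ^ (p ℕ.^ i) + (y ^ p) ^ (p ℕ.^ i)       ≡⟨ cong₂ _+_ (^-assocʳ x p (p ℕ.^ i)) (^-assocʳ y p (p ℕ.^ i)) ⟩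
      x ^ (p ℕ.* p ℕ.^ i) + y ^ (p ℕ.* p ℕ.^ i)       ∎

-- Quadratic maps and Dembowski-Ostrom polynomials

module QuadraticMaps {order : ℕ} (K : FiniteField order) where
  open FiniteField K
  open FiniteFieldProperties K
  open CommutativeRing commutativeRing using (ring; +-identityʳ)
  open import Algebra.Properties.Ring ring using (+-cancelˡ; +-inverseˡ-unique; -‿involutive)
  open import Algebra.Properties.Semiring.Mult semiring renaming (_×_ to _⊗_) using ()
  open import Algebra.Properties.Semiring.Exp semiring using (^-homo-*)
  open IntegerCoefficients commutativeRing using (solve; _:=_; _:+_; _:*_; :-_; _:-_; con)
  open ≡ using (refl; sym; trans; cong; cong₂; module ≡-Reasoning)
  open ≡-Reasoning

  additive-zero : ∀ {u} → Additive u → u 0# ≡ 0#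
  additive-zero {u} u-additive = sym (+-cancelˡ (u 0#) 0# (u 0#) (begin
    u 0# + 0#     ≡⟨ +-identityʳ _ ⟩
    u 0#          ≡⟨ cong u (+-identityʳ 0#) ⟨
    u (0# + 0#)   ≡⟨ u-additive 0# 0# ⟩
    u 0# + u 0#   ∎))

  additive-neg : ∀ {u} → Additive u → ∀ x → u (- x) ≡ - u x
  additive-neg {u} u-additive x = +-inverseˡ-unique (u (- x)) (u x) (begin
    u (- x) + u x   ≡⟨ u-additive (- x) x ⟨
    u (- x + x)     ≡⟨ cong u (solve 1 (λ x → :- x :+ x := con 0ℤ) refl x) ⟩
    u 0#            ≡⟨ additive-zero u-additive ⟩
    0#              ∎)

  -- The second condition says that the polar form f (x + y) - f x - f y is
  -- additive, with the terms moved so that no subtraction occurs.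
  record IsQuadratic (f : Carrier → Carrier) : Set where
    field
      even           : ∀ x → f (- x) ≡ f x
      polar-additive : ∀ x y z → f (x + y + z) + (f x + f y + f z) ≡ f (x + y) + f (x + z) + f (y + z)

  -- At the origin the polar identity balances four copies of `f 0#` against three.
  quadratic-zero : ∀ {f} → IsQuadratic f → f 0# ≡ 0#
  quadratic-zero {f} f-quadratic =
    +-cancelˡ (f 0# + f 0# + f 0#) (f 0#) 0# (begin
      f 0# + f 0# + f 0# + f 0#                     ≡⟨ solve 1 (λ a → a :+ a :+ a :+ a := a :+ (a :+ a :+ a)) refl (f 0#) ⟩
      f 0# + (f 0# + f 0# + f 0#)                   ≡⟨ cong (λ x → f x + (f 0# + f 0# + f 0#)) (trans (cong (_+ 0#) 0+0≡0) 0+0≡0) ⟨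
      f (0# + 0# + 0#) + (f 0# + f 0# + f 0#)       ≡⟨ polar-additive 0# 0# 0# ⟩
      f (0# + 0#) + f (0# + 0#) + f (0# + 0#)       ≡⟨ cong (λ x → f x + f x + f x) 0+0≡0 ⟩
      f 0# + f 0# + f 0#                            ≡⟨ +-identityʳ _ ⟨
      f 0# + f 0# + f 0# + 0#                       ∎)
    where
    open IsQuadratic f-quadratic
    0+0≡0 : 0# + 0# ≡ 0#
    0+0≡0 = +-identityʳ 0#

  -- The polar form is `c * (u x * v y + u y * v x)`, additive in each argument, and the signs of
  -- the two factors cancel.
  additive-product : ∀ {u v} → Additive u → Additive v → ∀ c → IsQuadratic (λ x → c * (u x * v x))
  additive-product {u} {v} u-additive v-additive c = record
    { even = λ x → trans
        (cong₂ (λ a b → c * (a * b)) (additive-neg u-additive x) (additive-neg v-additive x))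
        (solve 3 (λ c a b → c :* (:- a :* :- b) := c :* (a :* b)) refl c (u x) (v x))
    ; polar-additive = λ x y z → begin
        Q (x + y + z) + (Q x + Q y + Q z)
          ≡⟨ cong (_+ (Q x + Q y + Q z)) (cong₂ (λ a b → c * (a * b))
               (trans (u-additive (x + y) z) (cong (_+ u z) (u-additive x y)))
               (trans (v-additive (x + y) z) (cong (_+ v z) (v-additive x y)))) ⟩
        c * ((u x + u y + u z) * (v x + v y + v z)) + (Q x + Q y + Q z)
          ≡⟨ solve 7 (λ c a b d a′ b′ d′ →
               c :* ((a :+ b :+ d) :* (a′ :+ b′ :+ d′)) :+ (c :* (a :* a′) :+ c :* (b :* b′) :+ c :* (d :* d′))
               := c :* ((a :+ b) :* (a′ :+ b′)) :+ c :* ((a :+ d) :* (a′ :+ d′)) :+ c :* ((b :+ d) :* (b′ :+ d′)))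
               refl c (u x) (u y) (u z) (v x) (v y) (v z) ⟩
        c * ((u x + u y) * (v x + v y)) + c * ((u x + u z) * (v x + v z)) + c * ((u y + u z) * (v y + v z))
          ≡⟨ cong₂ _+_ (cong₂ _+_ (Q-+ x y) (Q-+ x z)) (Q-+ y z) ⟨
        Q (x + y) + Q (x + z) + Q (y + z) ∎
    }
    where
    Q : Carrier → Carrier
    Q x = c * (u x * v x)
    Q-+ : ∀ x y → Q (x + y) ≡ c * ((u x + u y) * (v x + v y))
    Q-+ x y = cong₂ (λ a b → c * (a * b)) (u-additive x y) (v-additive x y)

  sum-quadratic : ∀ n (Q : Fin n → Carrier → Carrier) → (∀ i → IsQuadratic (Q i)) →
                  IsQuadratic (λ x → sum λ i → Q i x)
  sum-quadratic zero    Q _ = record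
    { even           = λ _ → refl
    ; polar-additive = λ _ _ _ → solve 0 (o :+ (o :+ o :+ o) := o :+ o :+ o) refl
    }
    where o = con 0ℤ
  sum-quadratic (suc n) Q Q-quadratic = record
    { even           = λ x → cong₂ _+_ (head.even x) (tail.even x)
    ; polar-additive = λ x y z → trans
        (solve 8 (λ a b c d a′ b′ c′ d′ →
          (a :+ a′) :+ ((b :+ b′) :+ (c :+ c′) :+ (d :+ d′)) := (a :+ (b :+ c :+ d)) :+ (a′ :+ (b′ :+ c′ :+ d′)))
          refl (head (x + y + z)) (head x) (head y) (head z) (tail (x + y + z)) (tail x) (tail y) (tail z))
        (trans (cong₂ _+_ (head.polar-additive x y z) (tail.polar-additive x y z))
        (solve 6 (λ a b c a′ b′ c′ → (a :+ b :+ c) :+ (a′ :+ b′ :+ c′) := (a :+ a′) :+ (b :+ b′) :+ (c :+ c′))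
          refl (head (x + y)) (head (x + z)) (head (y + z)) (tail (x + y)) (tail (x + z)) (tail (y + z))))
    }
    where
    head tail : Carrier → Carrier
    head = Q zero
    tail x = sum λ i → Q (suc i) x
    module head = IsQuadratic (Q-quadratic zero)
    module tail = IsQuadratic (sum-quadratic n (λ i → Q (suc i)) (λ i → Q-quadratic (suc i)))

  -- The shape of the exponents enters here: `x ^ (p ^ i + p ^ j)` is the product of two iterates of
  -- Frobenius, both additive.
  eval-quadratic : ∀ {p} → Prime p → p ⊗ 1# ≡ 0# → ∀ P → IsQuadratic (eval K p P)
  eval-quadratic {p} p-prime p×1≡0 P =
    sum-quadratic bound _ λ i → sum-quadratic bound _ λ j → monomial i j
    where
    open DembowskiOstrom P
    monomial : ∀ i j → IsQuadratic (λ x → coeff i j * x ^ (p ℕ.^ toℕ i ℕ.+ p ℕ.^ toℕ j))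
    monomial i j = record
      { even           = λ x → trans (factor (- x)) (trans (product.even x) (sym (factor x)))
      ; polar-additive = λ x y z → trans
          (cong₂ _+_ (factor _) (cong₂ _+_ (cong₂ _+_ (factor x) (factor y)) (factor z)))
          (trans (product.polar-additive x y z)
          (sym (cong₂ _+_ (cong₂ _+_ (factor _) (factor _)) (factor _))))
      }
      where
      factor : ∀ x → coeff i j * x ^ (p ℕ.^ toℕ i ℕ.+ p ℕ.^ toℕ j)
                   ≡ coeff i j * (x ^ (p ℕ.^ toℕ i) * x ^ (p ℕ.^ toℕ j))
      factor x = cong (coeff i j *_) (^-homo-* x (p ℕ.^ toℕ i) (p ℕ.^ toℕ j))
      module product = IsQuadratic (additive-product
        (frobenius^-additive p-prime p×1≡0 (toℕ i)) (frobenius^-additive p-prime p×1≡0 (toℕ j)) (coeff i j))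

  module _ {f : Carrier → Carrier} (f-quadratic : IsQuadratic f) where
    open IsQuadratic f-quadratic

    -- The polar identity rewrites the combination as `f s + f y + f z - f (y + z)`, in which
    -- negating `y` and `z` together changes nothing.
    quadratic-reflect : ∀ s y z →
      f (s + - y) + f (s + - z) - f (s + - y + - z) ≡ f (s + y) + f (s + z) - f (s + y + z)
    quadratic-reflect s y z = begin
      f (s + - y) + f (s + - z) - f (s + - y + - z)   ≡⟨ expand (- y) (- z) ⟩
      f s + f (- y) + f (- z) - f (- y + - z)         ≡⟨ cong₂ _-_ (cong₂ (λ a b → f s + a + b) (even y) (even z))
                                                          (trans (cong f -y-z≡-[y+z]) (even (y + z))) ⟩
      f s + f y + f z - f (y + z)                     ≡⟨ expand y z ⟨
      f (s + y) + f (s + z) - f (s + y + z)           ∎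
      where
      -y-z≡-[y+z] : - y + - z ≡ - (y + z)
      -y-z≡-[y+z] = solve 2 (λ y z → :- y :+ :- z := :- (y :+ z)) refl y z
      expand : ∀ y z → f (s + y) + f (s + z) - f (s + y + z) ≡ f s + f y + f z - f (y + z)
      expand y z = begin
        f (s + y) + f (s + z) - f (s + y + z)
          ≡⟨ solve 4 (λ a b c d → a :+ b :- d := (a :+ b :+ c) :- d :- c)
               refl (f (s + y)) (f (s + z)) (f (y + z)) (f (s + y + z)) ⟩
        f (s + y) + f (s + z) + f (y + z) - f (s + y + z) - f (y + z)
          ≡⟨ cong (λ a → a - f (s + y + z) - f (y + z)) (polar-additive s y z) ⟨
        f (s + y + z) + (f s + f y + f z) - f (s + y + z) - f (y + z)
          ≡⟨ solve 3 (λ a b c → (a :+ b) :- a :- c := b :- c) refl (f (s + y + z)) (f s + f y + f z) (f (y + z)) ⟩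
        f s + f y + f z - f (y + z) ∎

    -- In direction `x + y` the difference map takes the value `f y - f x` at `- x` and `f x - f y`
    -- at `- y`. Both vanish when `f x ≡ f y`, so injectivity identifies the two arguments.
    planar-fibre : Planar K f → ∀ {x y} → f x ≡ f y → x ≡ y ⊎ x ≡ - y
    planar-fibre planar {x} {y} fx≡fy with (x + y) ≟ 0#
    ... | yes x+y≡0 = inj₂ (+-inverseˡ-unique x y x+y≡0)
    ... | no  x+y≢0 = inj₁ (begin
      x       ≡⟨ -‿involutive x ⟨
      - - x   ≡⟨ cong -_ (proj₁ (planar (x + y) x+y≢0) differences) ⟩
      - - y   ≡⟨ -‿involutive y ⟩
      y       ∎)
      where
      differences : f (- x + (x + y)) - f (- x) ≡ f (- y + (x + y)) - f (- y)
      differences = begin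
        f (- x + (x + y)) - f (- x)   ≡⟨ cong₂ (λ a b → f a - b) (solve 2 (λ x y → :- x :+ (x :+ y) := y) refl x y) (even x) ⟩
        f y - f x                     ≡⟨ cong₂ _-_ fx≡fy (sym fx≡fy) ⟨
        f x - f y                     ≡⟨ cong₂ (λ a b → f a - b) (solve 2 (λ x y → :- y :+ (x :+ y) := x) refl x y) (even y) ⟨
        f (- y + (x + y)) - f (- y)   ∎

-- Incidence in the plane of a planar function

module ShiftPlane {order : ℕ} (K : FiniteField order) (f : FiniteField.Carrier K → FiniteField.Carrier K) where
  open FiniteField K
  open FiniteFieldProperties K
  open QuadraticMaps K
  open CommutativeRing commutativeRing using (ring; -‿inverseʳ; +-comm)
  open import Algebra.Properties.Ring ring using (x∙y⁻¹≈ε⇒x≈y)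
  open IntegerCoefficients commutativeRing using (solve; _:=_; _:+_; :-_; _:-_)
  open ≡ using (refl; sym; trans; cong; cong₂; subst; module ≡-Reasoning)
  open ≡-Reasoning
  open Plane K f

  private
    variable
      a b x x′ y y′ : Carrier
      s t : Maybe Carrier
      l m : Line K
      P Q R : Point K
      S T : Pred (Point K) 0ℓ

  affine-injective : affine {K = K} x y ≡ affine x′ y′ → x ≡ x′ × y ≡ y′
  affine-injective refl = refl , refl

  affine∈L⁻ : affine x y ∈ pointsOn (L a b) → y ≡ f (x + a) - b
  affine∈L⁻ (inj₁ (_ , refl)) = refl

  affine∈L⁺ : y ≡ f (x + a) - b → affine x y ∈ pointsOn (L a b)
  affine∈L⁺ {x = x} refl = inj₁ (x , refl)

  affine∈N⁻ : affine x y ∈ pointsOn (N a) → x ≡ a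
  affine∈N⁻ (inj₁ (_ , refl)) = refl

  affine∈N⁺ : x ≡ a → affine x y ∈ pointsOn (N a)
  affine∈N⁺ {y = y} refl = inj₁ (y , refl)

  affine∉L∞ : affine x y ∉ pointsOn L∞
  affine∉L∞ (_ , ())

  ideal∈L⁻ : ideal s ∈ pointsOn (L a b) → s ≡ just a
  ideal∈L⁻ (inj₂ refl) = refl

  ideal∈N⁻ : ideal s ∈ pointsOn (N a) → s ≡ ∞
  ideal∈N⁻ (inj₂ refl) = refl

  -- The last clause is a default that makes the function total; joining two affine points would
  -- mean inverting a difference map of `f`.
  join : Point K → Point K → Line K
  join (affine x y) (ideal (just a)) = L a (f (x + a) - y)
  join (affine x y) (ideal ∞)        = N x
  join _            _                = L∞

  affine-ideal⇒line : affine x y ∈ pointsOn l → ideal s ∈ pointsOn l → l ≡ join (affine x y) (ideal s)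
  affine-ideal⇒line {x} {y} {L a b} A∈l (inj₂ refl) = cong (L a) (begin
    b                                     ≡⟨ solve 2 (λ b c → b := c :- (c :- b)) refl b (f (x + a)) ⟩
    f (x + a) - (f (x + a) - b)           ≡⟨ cong (λ z → f (x + a) - z) (affine∈L⁻ A∈l) ⟨
    f (x + a) - y                         ∎)
  affine-ideal⇒line {l = N a} A∈l (inj₂ refl) = cong N (sym (affine∈N⁻ A∈l))
  affine-ideal⇒line {l = L∞}  A∈l _ = contradiction A∈l affine∉L∞

  two-ideals⇒L∞ : s ≢ t → ideal s ∈ pointsOn l → ideal t ∈ pointsOn l → l ≡ L∞
  two-ideals⇒L∞ {l = L a b} s≢t s∈l t∈l = contradiction (trans (ideal∈L⁻ s∈l) (sym (ideal∈L⁻ t∈l))) s≢t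
  two-ideals⇒L∞ {l = N a}   s≢t s∈l t∈l = contradiction (trans (ideal∈N⁻ s∈l) (sym (ideal∈N⁻ t∈l))) s≢t
  two-ideals⇒L∞ {l = L∞}    _   _   _   = refl

  vertical : affine {K = K} x y ≢ affine x y′ → affine x y ∈ pointsOn l → affine x y′ ∈ pointsOn l → l ≡ N x
  vertical {l = L a b} A≢B A∈l B∈l =
    contradiction (cong (affine {K = K} _) (trans (affine∈L⁻ A∈l) (sym (affine∈L⁻ B∈l)))) A≢B
  vertical {l = N a}   _ A∈l _ = cong N (sym (affine∈N⁻ A∈l))
  vertical {l = L∞}    _ A∈l _ = contradiction A∈l affine∉L∞

  oblique : x ≢ x′ → affine x y ∈ pointsOn l → affine x′ y′ ∈ pointsOn l → ∃[ a ] ∃[ b ] l ≡ L {K = K} a b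
  oblique {l = L a b} _ _ _ = a , b , refl
  oblique {l = N a} x≢x′ A∈l B∈l = contradiction (trans (affine∈N⁻ A∈l) (sym (affine∈N⁻ B∈l))) x≢x′
  oblique {l = L∞}  _ A∈l _ = contradiction A∈l affine∉L∞

  record TangentAt (S : Pred (Point K) 0ℓ) (l : Line K) (Q : Point K) : Set where
    field
      on-line : Q ∈ pointsOn l
      on-set  : Q ∈ S
      unique  : R ∈ pointsOn l → R ∈ S → R ≡ Q

  module _ (φ : Point K ⤖ Point K) where
    open Bijection φ using (to; injective)

    -- A point of `m` in `T` has a preimage on `l` and a preimage in `S`; injectivity makes them one
    -- point, to which uniqueness applies.
    image-tangent : image to S ≐ T → image to (pointsOn l) ≐ pointsOn m →
                    TangentAt S l Q → TangentAt T m (to Q)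
    image-tangent {S = S} {l = l} {Q = Q} (φS⊆T , T⊆φS) (φl⊆m , m⊆φl) tangent = record
      { on-line = φl⊆m (Q , on-line , refl)
      ; on-set  = φS⊆T (Q , on-set , refl)
      ; unique  = λ R∈m R∈T → unique′ (m⊆φl R∈m) (T⊆φS R∈T)
      }
      where
      open TangentAt tangent
      unique′ : R ∈ image to (pointsOn l) → R ∈ image to S → R ≡ to Q
      unique′ (R′ , R′∈l , refl) (R″ , R″∈S , φR″≡φR′) =
        cong to (unique R′∈l (subst (_∈ S) (injective φR″≡φR′) R″∈S))

    image⁻ : image to (pointsOn l) ≐ pointsOn m → to R ∈ pointsOn m → R ∈ pointsOn l
    image⁻ {l = l} (_ , m⊆φl) φR∈m with R′ , R′∈l , φR′≡φR ← m⊆φl φR∈m =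
      subst (_∈ pointsOn l) (injective φR′≡φR) R′∈l

  module _ (planar : Planar K f) where

    -- A common point of abscissa `x` makes the difference map in direction `a - c` take the value
    -- `b - d` at `x + c`. For `a ≢ c` planarity leaves room for only one abscissa.
    parallel-classes : x ≢ x′ → affine x y ∈ pointsOn (L a b) → affine x′ y′ ∈ pointsOn (L a b) →
                 ∀ {c d} → affine x y ∈ pointsOn (L c d) → affine x′ y′ ∈ pointsOn (L c d) → L {K = K} a b ≡ L c d
    parallel-classes {x} {x′} {y} {a} {b} {y′} x≢x′ A∈l B∈l {c} {d} A∈m B∈m with (a - c) ≟ 0#
    ... | no  a-c≢0 = contradiction x≡x′ x≢x′
      where
      difference : ∀ {x y} → affine x y ∈ pointsOn (L a b) → affine x y ∈ pointsOn (L c d) →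
                   f (x + c + (a - c)) - f (x + c) ≡ b - d
      difference {x} {y} A∈l A∈m = begin
        f (x + c + (a - c)) - f (x + c)   ≡⟨ cong (λ z → f z - f (x + c)) (solve 3 (λ x a c → x :+ c :+ (a :- c) := x :+ a) refl x a c) ⟩
        f (x + a) - f (x + c)             ≡⟨ solve 4 (λ u v b d → u :- v := (u :- b) :- (v :- d) :+ (b :- d)) refl _ _ b d ⟩
        (f (x + a) - b) - (f (x + c) - d) + (b - d)  ≡⟨ cong₂ (λ u v → u - v + (b - d)) (affine∈L⁻ A∈l) (affine∈L⁻ A∈m) ⟨
        y - y + (b - d)                   ≡⟨ solve 3 (λ y b d → y :- y :+ (b :- d) := b :- d) refl y b d ⟩
        b - d                             ∎
      x≡x′ : x ≡ x′
      x≡x′ = begin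
        x            ≡⟨ solve 2 (λ x c → x := x :+ c :- c) refl x c ⟩
        x + c - c    ≡⟨ cong (_- c) (proj₁ (planar (a - c) a-c≢0) (trans (difference A∈l A∈m) (sym (difference B∈l B∈m)))) ⟩
        x′ + c - c   ≡⟨ solve 2 (λ x c → x := x :+ c :- c) refl x′ c ⟨
        x′           ∎
    ... | yes a-c≡0 with refl ← x∙y⁻¹≈ε⇒x≈y a c a-c≡0 = cong (L a) (begin
      b                            ≡⟨ solve 2 (λ b v → b := v :- (v :- b)) refl b (f (x + a)) ⟩
      f (x + a) - (f (x + a) - b)  ≡⟨ cong (λ z → f (x + a) - z) (trans (sym (affine∈L⁻ A∈l)) (affine∈L⁻ A∈m)) ⟩
      f (x + a) - (f (x + a) - d)  ≡⟨ solve 2 (λ b v → b := v :- (v :- b)) refl d (f (x + a)) ⟨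
      d                            ∎)

    two-points⇒line : ∀ {l m} P Q → P ≢ Q → P ∈ pointsOn l → Q ∈ pointsOn l → P ∈ pointsOn m → Q ∈ pointsOn m → l ≡ m
    two-points⇒line (ideal s) (ideal t) P≢Q P∈l Q∈l P∈m Q∈m =
      trans (two-ideals⇒L∞ s≢t P∈l Q∈l) (sym (two-ideals⇒L∞ s≢t P∈m Q∈m))
      where
      s≢t : s ≢ t
      s≢t s≡t = P≢Q (cong ideal s≡t)
    two-points⇒line (affine _ _) (ideal _) _ P∈l Q∈l P∈m Q∈m =
      trans (affine-ideal⇒line P∈l Q∈l) (sym (affine-ideal⇒line P∈m Q∈m))
    two-points⇒line (ideal _) (affine _ _) _ P∈l Q∈l P∈m Q∈m =
      trans (affine-ideal⇒line Q∈l P∈l) (sym (affine-ideal⇒line Q∈m P∈m))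
    two-points⇒line {l} {m} (affine x y) (affine x′ y′) P≢Q P∈l Q∈l P∈m Q∈m with x ≟ x′
    ... | yes refl = trans (vertical P≢Q P∈l Q∈l) (sym (vertical P≢Q P∈m Q∈m))
    ... | no  x≢x′ with _ , _ , refl ← oblique {l = l} x≢x′ P∈l Q∈l | _ , _ , refl ← oblique {l = m} x≢x′ P∈m Q∈m =
      parallel-classes x≢x′ P∈l Q∈l P∈m Q∈m

  -- The polarity of `κ` and the tangents of `𝒰 κ`

  module Polarity (f-quadratic : IsQuadratic f) (2≢0 : 1# + 1# ≢ 0#)
                  (κ : Carrier → Carrier) (κ-additive : Additive κ) (κ-involutive : ∀ x → κ (κ x) ≡ x)
                  (κ-f : ∀ x → κ (f x) ≡ f (κ x))
                  (vertical-point : ∀ x → ∃[ y ] y + κ y ≡ f (x + κ x)) where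

    pole : Point K → Line K
    pole (affine x y)     = L (κ x) (κ y)
    pole (ideal (just a)) = N (κ a)
    pole (ideal ∞)        = L∞

    κ-‿- : ∀ x y → κ (x - y) ≡ κ x - κ y
    κ-‿- x y = trans (κ-additive x (- y)) (cong (κ x +_) (additive-neg κ-additive y))

    -- Applying `κ` to `y = f (x + κ u) - κ v` exchanges the roles of the two points, because `κ` is
    -- an additive involution commuting with `f`.
    pole-sym : ∀ P Q → P ∈ pointsOn (pole Q) → Q ∈ pointsOn (pole P)
    pole-sym (affine x y) (affine u v) P∈q = affine∈L⁺ (begin
      v                                      ≡⟨ solve 2 (λ v w → v := w :- (w :- v)) refl v (f (u + κ x)) ⟩
      f (u + κ x) - (f (u + κ x) - v)        ≡⟨ cong (λ z → f (u + κ x) - z) (begin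
        κ y                                    ≡⟨ cong κ (affine∈L⁻ P∈q) ⟩
        κ (f (x + κ u) - κ v)                  ≡⟨ κ-‿- _ _ ⟩
        κ (f (x + κ u)) - κ (κ v)              ≡⟨ cong₂ _-_ (κ-f _) (κ-involutive v) ⟩
        f (κ (x + κ u)) - v                    ≡⟨ cong (λ z → f z - v) (κ-additive x (κ u)) ⟩
        f (κ x + κ (κ u)) - v                  ≡⟨ cong (λ z → f z - v) (trans (cong (κ x +_) (κ-involutive u)) (+-comm _ _)) ⟩
        f (u + κ x) - v                        ∎) ⟨
      f (u + κ x) - κ y                      ∎)
    pole-sym (affine x y) (ideal (just a)) P∈q =
      inj₂ (cong (λ z → ideal (just z)) (trans (cong κ (affine∈N⁻ P∈q)) (κ-involutive a)))
    pole-sym (affine x y) (ideal ∞) P∈q = contradiction P∈q affine∉L∞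
    pole-sym (ideal (just a)) (affine u v) (inj₂ refl) = affine∈N⁺ (sym (κ-involutive u))
    pole-sym (ideal (just a)) (ideal (just b)) (inj₂ ())
    pole-sym (ideal (just a)) (ideal ∞) _ = inj₂ refl
    pole-sym (ideal ∞) (affine u v) (inj₂ ())
    pole-sym (ideal ∞) (ideal t) _ = t , refl

    affine∈𝒰⁻ : affine x y ∈ 𝒰 κ → y + κ y ≡ f (x + κ x)
    affine∈𝒰⁻ (inj₁ (_ , _ , refl , eq)) = eq

    affine∈𝒰⁺ : y + κ y ≡ f (x + κ x) → affine x y ∈ 𝒰 κ
    affine∈𝒰⁺ eq = inj₁ (_ , _ , refl , eq)

    module _ (a b : Carrier) where
      private
        c = a + κ a
        -- With `u = x - κ a` and its conjugate `κ u = κ x - a`, the arguments `x + a`, `κ x + κ a`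
        -- and `x + κ x` become `c + u`, `c + κ u` and `c + u + κ u`: the form to which
        -- `quadratic-reflect` applies.
        φ : Carrier → Carrier
        φ x = f (c + (x - κ a)) + f (c + (κ x - a)) - f (c + (x - κ a) + (κ x - a))

      -- φ depends on x only through x - κ a, and evenly so.
      line-equation : ∀ x → let y = f (x + a) - b in y + κ y - f (x + κ x) ≡ φ x - (b + κ b)
      line-equation x = begin
        f (x + a) - b + κ (f (x + a) - b) - f (x + κ x)
          ≡⟨ cong (λ z → f (x + a) - b + z - f (x + κ x)) (trans (κ-‿- _ b) (cong (_- κ b) (trans (κ-f _) (cong f (κ-additive x a))))) ⟩
        f (x + a) - b + (f (κ x + κ a) - κ b) - f (x + κ x)
          ≡⟨ solve 5 (λ u b v d w → u :- b :+ (v :- d) :- w := u :+ v :- w :- (b :+ d)) refl _ b _ (κ b) _ ⟩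
        f (x + a) + f (κ x + κ a) - f (x + κ x) - (b + κ b)
          ≡⟨ cong (_- (b + κ b)) (cong₂ _-_ (cong₂ (λ u v → f u + f v)
               (solve 3 (λ x a a′ → x :+ a := a :+ a′ :+ (x :- a′)) refl x a (κ a))
               (solve 3 (λ x a a′ → x :+ a′ := a :+ a′ :+ (x :- a)) refl (κ x) a (κ a)))
               (cong f (solve 4 (λ x x′ a a′ → x :+ x′ := a :+ a′ :+ (x :- a′) :+ (x′ :- a)) refl x (κ x) a (κ a)))) ⟩
        φ x - (b + κ b) ∎

      reflect : Carrier → Carrier
      reflect x = κ a + κ a - x

      -- The reflection negates `x - κ a`, and with it the conjugate `κ x - a`.
      φ-reflect : ∀ x → φ (reflect x) ≡ φ x
      φ-reflect x = trans (cong₂ (λ u v → f (c + u) + f (c + v) - f (c + u + v))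
        (solve 2 (λ a′ x → a′ :+ a′ :- x :- a′ := :- (x :- a′)) refl (κ a) x)
        (begin
          κ (κ a + κ a - x) - a            ≡⟨ cong (_- a) (trans (κ-‿- _ x) (cong (_- κ x) (κ-additive _ _))) ⟩
          κ (κ a) + κ (κ a) - κ x - a      ≡⟨ cong (λ z → z + z - κ x - a) (κ-involutive a) ⟩
          a + a - κ x - a                  ≡⟨ solve 2 (λ a x → a :+ a :- x :- a := :- (x :- a)) refl a (κ x) ⟩
          - (κ x - a)                      ∎))
        (quadratic-reflect f-quadratic c (x - κ a) (κ x - a))

      reflect∈𝒰 : ∀ x → affine x (f (x + a) - b) ∈ 𝒰 κ → affine (reflect x) (f (reflect x + a) - b) ∈ 𝒰 κ
      reflect∈𝒰 x P∈𝒰 = affine∈𝒰⁺ (x∙y⁻¹≈ε⇒x≈y _ _ (begin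
        f (reflect x + a) - b + κ (f (reflect x + a) - b) - f (reflect x + κ (reflect x)) ≡⟨ line-equation (reflect x) ⟩
        φ (reflect x) - (b + κ b)    ≡⟨ cong (_- (b + κ b)) (φ-reflect x) ⟩
        φ x - (b + κ b)              ≡⟨ line-equation x ⟨
        f (x + a) - b + κ (f (x + a) - b) - f (x + κ x)   ≡⟨ cong (_- f (x + κ x)) (affine∈𝒰⁻ P∈𝒰) ⟩
        f (x + κ x) - f (x + κ x)    ≡⟨ -‿inverseʳ _ ⟩
        0#                           ∎))

      reflect-fixed : ∀ {x} → reflect x ≡ x → x ≡ κ a
      reflect-fixed {x} fixed = sym (x∙y⁻¹≈ε⇒x≈y _ _ (x+x≡0⇒x≡0 2≢0 (begin
        κ a - x + (κ a - x)   ≡⟨ solve 2 (λ a x → a :- x :+ (a :- x) := (a :+ a :- x) :- x) refl (κ a) x ⟩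
        reflect x - x         ≡⟨ cong (_- x) fixed ⟩
        x - x                 ≡⟨ -‿inverseʳ x ⟩
        0#                    ∎)))

    tangent⇒pole : ∀ l Q → TangentAt (𝒰 κ) l Q → l ≡ pole Q
    tangent⇒pole (L a b) (ideal s) tangent with inj₂ refl ← TangentAt.on-set tangent
                                              | inj₂ () ← TangentAt.on-line tangent
    tangent⇒pole (L a b) (affine x y) tangent with refl ← affine∈L⁻ (TangentAt.on-line tangent) =
      cong₂ L a≡κx b≡κy
      where
      open TangentAt tangent
      x≡κa : x ≡ κ a
      -- The reflected point lies on the line and in the set too, so tangency makes it the foot
      -- itself.
      x≡κa = reflect-fixed a b (proj₁ (affine-injective
        (unique (affine∈L⁺ refl) (reflect∈𝒰 a b x on-set))))
      a≡κx : a ≡ κ x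
      a≡κx = trans (sym (κ-involutive a)) (cong κ (sym x≡κa))
      b≡κy : b ≡ κ y
      b≡κy = begin
        -- Once `a` is `κ x`, the equations of the line and of the set contain the same value
        -- `f (x + κ x)`; comparing them leaves `κ y`.
        b                              ≡⟨ solve 2 (λ b v → b := v :- (v :- b)) refl b (f (x + a)) ⟩
        f (x + a) - (f (x + a) - b)    ≡⟨ cong (λ z → f (x + z) - y) a≡κx ⟩
        f (x + κ x) - y                ≡⟨ cong (_- y) (affine∈𝒰⁻ on-set) ⟨
        y + κ y - y                    ≡⟨ solve 2 (λ y z → y :+ z :- y := z) refl y (κ y) ⟩
        κ y                            ∎
    -- A line `N a` is never tangent: besides (∞) it carries the affine point of the set supplied by
    -- `vertical-point`.
    tangent⇒pole (N a) Q tangent with y , y∈𝒰 ← vertical-point a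
      with () ← trans (TangentAt.unique tangent (inj₂ refl) (inj₂ refl))
                      (sym (TangentAt.unique tangent {affine a y} (affine∈N⁺ refl) (affine∈𝒰⁺ y∈𝒰)))
    tangent⇒pole L∞ (affine _ _) tangent = contradiction (TangentAt.on-line tangent) affine∉L∞
    tangent⇒pole L∞ (ideal s) tangent with inj₂ refl ← TangentAt.on-set tangent = refl

    -- The polar of the image of `P` and the image `m′` of `m` share the images of two distinct
    -- feet, so they coincide. The third foot is pulled back from there to `m`.
    feet-collinear : Planar K f → ∀ {S} → Equivalent S (𝒰 κ) →
      ∀ P {l₁ l₂ l₃ Q₁ Q₂ Q₃} → TangentAt S l₁ Q₁ → TangentAt S l₂ Q₂ → TangentAt S l₃ Q₃ →
      P ∈ pointsOn l₁ → P ∈ pointsOn l₂ → P ∈ pointsOn l₃ →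
      Q₁ ≢ Q₂ → ∀ m → Q₁ ∈ pointsOn m → Q₂ ∈ pointsOn m → Q₃ ∈ pointsOn m
    feet-collinear planar {S} (φ , collineation , φS≐𝒰) P {Q₁ = Q₁} {Q₂} {Q₃}
      tangent₁ tangent₂ tangent₃ P∈l₁ P∈l₂ P∈l₃ Q₁≢Q₂ m Q₁∈m Q₂∈m
      with m′ , φm≐m′ ← collineation m =
      image⁻ φ {l = m} {m = m′} {R = Q₃} φm≐m′ (subst (λ l → to Q₃ ∈ pointsOn l) pole≡m′ (foot∈pole tangent₃ P∈l₃))
      where
      open Bijection φ using (to; injective)
      -- The image of the tangent is tangent to `𝒰 κ`, hence it is `pole (to Q)`; it contains
      -- `to P`, and `pole-sym` reverses this incidence.
      foot∈pole : ∀ {l Q} → TangentAt S l Q → P ∈ pointsOn l → to Q ∈ pointsOn (pole (to P))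
      foot∈pole {l} {Q} tangent P∈l with l′ , φl≐l′ ← collineation l = pole-sym (to P) (to Q)
        (subst (λ l → to P ∈ pointsOn l) (tangent⇒pole l′ (to Q) (image-tangent φ φS≐𝒰 φl≐l′ tangent))
          (proj₁ φl≐l′ (P , P∈l , refl)))
      pole≡m′ : pole (to P) ≡ m′
      pole≡m′ = two-points⇒line planar (to Q₁) (to Q₂) (λ φQ₁≡φQ₂ → Q₁≢Q₂ (injective φQ₁≡φQ₂))
        (foot∈pole tangent₁ P∈l₁) (foot∈pole tangent₂ P∈l₂)
        (proj₁ φm≐m′ (Q₁ , Q₁∈m , refl)) (proj₁ φm≐m′ (Q₂ , Q₂∈m , refl))

-- Elements obtained from cardinalities

HasSize1⇒≡ : {A : Set} {S : Pred A 0ℓ} → HasSize S 1 → ∀ {x y} → x ∈ S → y ∈ S → x ≡ y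
HasSize1⇒≡ (e , _ , enum) x∈S y∈S
  with zero , ≡.refl ← Equivalence.to (enum _) x∈S
     | zero , ≡.refl ← Equivalence.to (enum _) y∈S = ≡.refl

HasSize⇒inhabited : {A : Set} {S : Pred A 0ℓ} {n : ℕ} → 1 ℕ.≤ n → HasSize S n → ∃[ x ] x ∈ S
HasSize⇒inhabited (s≤s _) (e , _ , enum) = e zero , Equivalence.from (enum _) (zero , ≡.refl)

HasSize⇒avoid-two : {A : Set} → DecidableEquality A → {S : Pred A 0ℓ} {n : ℕ} → 3 ℕ.≤ n → HasSize S n →
                    ∀ a b → ∃[ x ] x ∈ S × x ≢ a × x ≢ b
HasSize⇒avoid-two _≟_ {S} (s≤s (s≤s (s≤s _))) (e , e-injective , enum) a b = go (e zero ≟ a) (e zero ≟ b)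
  where
  e∈S : ∀ i → e i ∈ S
  e∈S i = Equivalence.from (enum _) (i , ≡.refl)
  differ : ∀ {i j c} → e i ≡ c → i ≢ j → e j ≢ c
  differ ei≡c i≢j ej≡c = i≢j (e-injective (≡.trans ei≡c (≡.sym ej≡c)))
  go : _ → _ → ∃[ x ] x ∈ S × x ≢ a × x ≢ b
  go (no e₀≢a) (no e₀≢b) = e zero , e∈S _ , e₀≢a , e₀≢b
  go (yes e₀≡a) _ with e (suc zero) ≟ b
  ... | no  e₁≢b = e (suc zero) , e∈S _ , differ e₀≡a (λ ()) , e₁≢b
  ... | yes e₁≡b = e (suc (suc zero)) , e∈S _ , differ e₀≡a (λ ()) , differ e₁≡b (λ ())
  go (no _) (yes e₀≡b) with e (suc zero) ≟ a
  ... | no  e₁≢a = e (suc zero) , e∈S _ , e₁≢a , differ e₀≡b (λ ())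
  ... | yes e₁≡a = e (suc (suc zero)) , e∈S _ , differ e₁≡a (λ ()) , differ e₀≡b (λ ())

-- Coordinates over the subfield and classes modulo `F θ`

module Coordinates {order : ℕ} (K : FiniteField order) (F : Pred (FiniteField.Carrier K) 0ℓ)
                   (F-subfield : IsSubfield K F) (ξ : FiniteField.Carrier K) (ξ∉F : ξ ∉ F) where
  open FiniteField K
  open FiniteFieldProperties K
  open IsSubfield F-subfield
  open CommutativeRing commutativeRing using (ring; *-identityʳ; *-identityˡ; zeroˡ; -‿inverseʳ; zeroʳ; +-identityˡ)
  open import Algebra.Properties.Ring ring using (x∙y⁻¹≈ε⇒x≈y)
  open IntegerCoefficients commutativeRing using (solve; _:=_; _:+_; _:*_; :-_; _:-_)
  open ≡ using (refl; sym; trans; cong; cong₂; subst; module ≡-Reasoning)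
  open ≡-Reasoning

  minus-closed : ∀ {x y} → x ∈ F → y ∈ F → x - y ∈ F
  minus-closed x∈F y∈F = +-closed x∈F (neg-closed y∈F)

  -- Different `ξ`-coordinates would express `ξ` as the quotient of `c - a` by `b - d`, an element
  -- of `F`.
  coordinates-unique : ∀ {a b c d} → a ∈ F → b ∈ F → c ∈ F → d ∈ F →
                       a + b * ξ ≡ c + d * ξ → a ≡ c × b ≡ d
  coordinates-unique {a} {b} {c} {d} a∈F b∈F c∈F d∈F eq with (b - d) ≟ 0#
  ... | yes b-d≡0 with refl ← x∙y⁻¹≈ε⇒x≈y b d b-d≡0 = (begin
    a                    ≡⟨ solve 2 (λ a z → a := a :+ z :- z) refl a (b * ξ) ⟩
    a + b * ξ - b * ξ    ≡⟨ cong (_- b * ξ) eq ⟩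
    c + b * ξ - b * ξ    ≡⟨ solve 2 (λ a z → a := a :+ z :- z) refl c (b * ξ) ⟨
    c                    ∎) , refl
  ... | no b-d≢0 with r , [b-d]r≡1 ← x≢0⇒invertible b-d≢0 = contradiction
    (subst (_∈ F) (sym ξ≡[c-a]r) (*-closed (minus-closed c∈F a∈F) (inv-closed (minus-closed b∈F d∈F) [b-d]r≡1)))
    ξ∉F
    where
    ξ≡[c-a]r : ξ ≡ (c - a) * r
    ξ≡[c-a]r = begin
      ξ                                  ≡⟨ *-identityˡ ξ ⟨
      1# * ξ                             ≡⟨ cong (_* ξ) [b-d]r≡1 ⟨
      (b - d) * r * ξ                    ≡⟨ solve 5 (λ a b d r x → (b :- d) :* r :* x := ((a :+ b :* x) :- (a :+ d :* x)) :* r) refl a b d r ξ ⟩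
      ((a + b * ξ) - (a + d * ξ)) * r    ≡⟨ cong (λ z → (z - (a + d * ξ)) * r) eq ⟩
      ((c + d * ξ) - (a + d * ξ)) * r    ≡⟨ solve 5 (λ a c d r x → ((c :+ d :* x) :- (a :+ d :* x)) :* r := (c :- a) :* r) refl a c d r ξ ⟩
      (c - a) * r                        ∎

  module Functional {θ θ₀ θ₁ : Carrier} (θ₀∈F : θ₀ ∈ F) (θ₁∈F : θ₁ ∈ F) (θ≡ : θ ≡ θ₀ + θ₁ * ξ) where

    -- For z = z₀ + z₁ ξ the value θ₁ z₀ - θ₀ z₁ determines z modulo F θ.
    functional-cong : ∀ {z₀ z₁ w₀ w₁ t} → z₀ ∈ F → z₁ ∈ F → w₀ ∈ F → w₁ ∈ F → t ∈ F →
      z₀ + z₁ * ξ ≡ w₀ + w₁ * ξ + t * θ → θ₁ * z₀ - θ₀ * z₁ ≡ θ₁ * w₀ - θ₀ * w₁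
    functional-cong {z₀} {z₁} {w₀} {w₁} {t} z₀∈F z₁∈F w₀∈F w₁∈F t∈F eq
      with refl , refl ← coordinates-unique z₀∈F z₁∈F
        (+-closed w₀∈F (*-closed t∈F θ₀∈F)) (+-closed w₁∈F (*-closed t∈F θ₁∈F)) (begin
          z₀ + z₁ * ξ                                 ≡⟨ eq ⟩
          w₀ + w₁ * ξ + t * θ                         ≡⟨ cong (λ z → w₀ + w₁ * ξ + t * z) θ≡ ⟩
          w₀ + w₁ * ξ + t * (θ₀ + θ₁ * ξ)             ≡⟨ solve 6 (λ w₀ w₁ x t a b → w₀ :+ w₁ :* x :+ t :* (a :+ b :* x)
                                                            := w₀ :+ t :* a :+ (w₁ :+ t :* b) :* x) refl w₀ w₁ ξ t θ₀ θ₁ ⟩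
          w₀ + t * θ₀ + (w₁ + t * θ₁) * ξ             ∎)
      = solve 5 (λ w₀ w₁ t a b → b :* (w₀ :+ t :* a) :- a :* (w₁ :+ t :* b) := b :* w₀ :- a :* w₁) refl w₀ w₁ t θ₀ θ₁

    -- The vanishing determinant makes `(u , v)` proportional to `(θ₀ , θ₁)`. The factor is found by
    -- dividing by whichever coordinate of `θ` is nonzero.
    functional-kernel : θ ≢ 0# → ∀ {u v} → u ∈ F → v ∈ F → θ₁ * u - θ₀ * v ≡ 0# →
                        ∃[ t ] t ∈ F × u + v * ξ ≡ t * θ
    functional-kernel θ≢0 {u} {v} u∈F v∈F θ₁u-θ₀v≡0 = go (θ₁ ≟ 0#) (θ₀ ≟ 0#)
      where
      θ₁u≡θ₀v : θ₁ * u ≡ θ₀ * v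
      θ₁u≡θ₀v = x∙y⁻¹≈ε⇒x≈y _ _ θ₁u-θ₀v≡0

      scale : ∀ {a r} → a * r ≡ 1# → ∀ x → x ≡ x * r * a
      scale {a} {r} ar≡1 x = begin
        x             ≡⟨ *-identityʳ x ⟨
        x * 1#        ≡⟨ cong (x *_) ar≡1 ⟨
        x * (a * r)   ≡⟨ solve 3 (λ x a r → x :* (a :* r) := x :* r :* a) refl x a r ⟩
        x * r * a     ∎

      combine : ∀ {t} → u ≡ t * θ₀ → v ≡ t * θ₁ → u + v * ξ ≡ t * θ
      combine {t} u≡tθ₀ v≡tθ₁ = begin
        u + v * ξ                 ≡⟨ cong₂ (λ a b → a + b * ξ) u≡tθ₀ v≡tθ₁ ⟩
        t * θ₀ + t * θ₁ * ξ       ≡⟨ solve 4 (λ t a b x → t :* a :+ t :* b :* x := t :* (a :+ b :* x)) refl t θ₀ θ₁ ξ ⟩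
        t * (θ₀ + θ₁ * ξ)         ≡⟨ cong (t *_) θ≡ ⟨
        t * θ                     ∎

      go : Dec (θ₁ ≡ 0#) → Dec (θ₀ ≡ 0#) → ∃[ t ] t ∈ F × u + v * ξ ≡ t * θ
      go (no θ₁≢0) _ with r , θ₁r≡1 ← x≢0⇒invertible θ₁≢0 =
        v * r , *-closed v∈F (inv-closed θ₁∈F θ₁r≡1) , combine (begin
          u             ≡⟨ scale θ₁r≡1 u ⟩
          u * r * θ₁    ≡⟨ solve 3 (λ u r a → u :* r :* a := a :* u :* r) refl u r θ₁ ⟩
          θ₁ * u * r    ≡⟨ cong (_* r) θ₁u≡θ₀v ⟩
          θ₀ * v * r    ≡⟨ solve 3 (λ v r a → a :* v :* r := v :* r :* a) refl v r θ₀ ⟩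
          v * r * θ₀    ∎) (scale θ₁r≡1 v)
      go (yes θ₁≡0) (no θ₀≢0) with r , θ₀r≡1 ← x≢0⇒invertible θ₀≢0 =
        u * r , *-closed u∈F (inv-closed θ₀∈F θ₀r≡1) , combine (scale θ₀r≡1 u) (begin
          -- With `θ₁ ≡ 0#` the determinant relation reduces to `θ₀ * v ≡ 0#`.
          v             ≡⟨ x*y≡0⇒y≡0 θ₀≢0 (trans (sym θ₁u≡θ₀v) (trans (cong (_* u) θ₁≡0) (zeroˡ u))) ⟩
          0#            ≡⟨ zeroʳ (u * r) ⟨
          u * r * 0#    ≡⟨ cong (u * r *_) θ₁≡0 ⟨
          u * r * θ₁    ∎)
      go (yes θ₁≡0) (yes θ₀≡0) = contradiction (begin
        θ               ≡⟨ θ≡ ⟩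
        θ₀ + θ₁ * ξ     ≡⟨ cong₂ (λ a b → a + b * ξ) θ₀≡0 θ₁≡0 ⟩
        0# + 0# * ξ     ≡⟨ trans (+-identityˡ _) (zeroˡ ξ) ⟩
        0#              ∎) θ≢0

    functional-fibre : θ ≢ 0# → ∀ {z₀ z₁ w₀ w₁} → z₀ ∈ F → z₁ ∈ F → w₀ ∈ F → w₁ ∈ F →
      θ₁ * z₀ - θ₀ * z₁ ≡ θ₁ * w₀ - θ₀ * w₁ →
      ∃[ t ] t ∈ F × (z₀ + z₁ * ξ) - (w₀ + w₁ * ξ) ≡ t * θ
    functional-fibre θ≢0 {z₀} {z₁} {w₀} {w₁} z₀∈F z₁∈F w₀∈F w₁∈F eq
      with t , t∈F , difference≡tθ ← functional-kernel θ≢0 (minus-closed z₀∈F w₀∈F) (minus-closed z₁∈F w₁∈F) (begin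
        θ₁ * (z₀ - w₀) - θ₀ * (z₁ - w₁)
          ≡⟨ solve 6 (λ a b z₀ z₁ w₀ w₁ → b :* (z₀ :- w₀) :- a :* (z₁ :- w₁)
               := b :* z₀ :- a :* z₁ :- (b :* w₀ :- a :* w₁)) refl θ₀ θ₁ z₀ z₁ w₀ w₁ ⟩
        θ₁ * z₀ - θ₀ * z₁ - (θ₁ * w₀ - θ₀ * w₁)   ≡⟨ cong (_- (θ₁ * w₀ - θ₀ * w₁)) eq ⟩
        θ₁ * w₀ - θ₀ * w₁ - (θ₁ * w₀ - θ₀ * w₁)   ≡⟨ -‿inverseʳ _ ⟩
        0#                                        ∎)
      = t , t∈F , trans
        (solve 5 (λ z₀ z₁ w₀ w₁ x → z₀ :+ z₁ :* x :- (w₀ :+ w₁ :* x) := z₀ :- w₀ :+ (z₁ :- w₁) :* x) refl z₀ z₁ w₀ w₁ ξ)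
        difference≡tθ

-- Tangents of 𝒰_θ and the contradiction

module NotEquivalent {order : ℕ} (K : FiniteField order) (f : FiniteField.Carrier K → FiniteField.Carrier K) where
  open FiniteField K
  open FiniteFieldProperties K
  open QuadraticMaps K
  open ShiftPlane K f
  open Plane K f
  open CommutativeRing commutativeRing using (ring; distribʳ; -‿inverseʳ; +-identityʳ; zeroˡ)
  open import Algebra.Properties.Ring ring using (x∙y⁻¹≈ε⇒x≈y; -‿distribˡ-*)
  open IntegerCoefficients commutativeRing using (solve; _:=_; _:+_; :-_; _:-_; con)
  open ≡ using (refl; sym; trans; cong; cong₂; module ≡-Reasoning)
  open ≡-Reasoning

  module _ {F : Pred Carrier 0ℓ} (F-subfield : IsSubfield K F) {θ : Carrier}
           (f-quadratic : IsQuadratic f) (θ-anisotropic : ∀ {x t} → t ∈ F → f x ≡ t * θ → x ≡ 0#) where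
    open IsSubfield F-subfield
    open IsQuadratic f-quadratic

    -- At a common affine point of abscissa `x` and ordinate `s * θ`, `f (x - z)` equals
    -- `(s + t) * θ`, and anisotropy gives `x ≡ z`. The remaining point (∞) lies on no line `L a b`.
    𝒰θ-tangent : ∀ z {b t} → t ∈ F → b ≡ t * θ → TangentAt 𝒰[ F , θ ] (L (- z) b) (affine z (- b))
    𝒰θ-tangent z {b} {t} t∈F refl = record
      { on-line = affine∈L⁺ (begin
          - b               ≡⟨ solve 1 (λ b → :- b := con 0ℤ :- b) refl b ⟩
          0# - b            ≡⟨ cong (_- b) (trans (cong f (-‿inverseʳ z)) (quadratic-zero f-quadratic)) ⟨
          f (z - z) - b     ∎)
      ; on-set  = inj₁ (_ , - t , neg-closed t∈F , cong (affine z) (-‿distribˡ-* t θ))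
      ; unique  = unique
      }
      where
      unique : ∀ {R} → R ∈ pointsOn (L (- z) b) → R ∈ 𝒰[ F , θ ] → R ≡ affine z (- b)
      unique R∈l (inj₁ (x , s , s∈F , refl)) with refl ← x∙y⁻¹≈ε⇒x≈y x z
        (θ-anisotropic (+-closed s∈F t∈F) (begin
          f (x - z)                 ≡⟨ solve 2 (λ u b → u := u :- b :+ b) refl (f (x - z)) b ⟩
          f (x - z) - b + b         ≡⟨ cong (_+ b) (affine∈L⁻ R∈l) ⟨
          s * θ + t * θ             ≡⟨ distribʳ θ s t ⟨
          (s + t) * θ               ∎)) =
        cong (affine z) (trans (affine∈L⁻ R∈l) (trans
          (cong (_- b) (trans (cong f (-‿inverseʳ z)) (quadratic-zero f-quadratic)))
          (solve 1 (λ b → con 0ℤ :- b := :- b) refl b)))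
      unique (inj₁ (_ , ())) (inj₂ refl)
      unique (inj₂ ()) (inj₂ refl)

    module _ (planar : Planar K f) (2≢0 : 1# + 1# ≢ 0#)
             (κ : Carrier → Carrier) (κ-additive : Additive κ) (κ-involutive : ∀ x → κ (κ x) ≡ x)
             (κ-f : ∀ x → κ (f x) ≡ f (κ x)) (vertical-point : ∀ x → ∃[ y ] y + κ y ≡ f (x + κ x)) where
      open Polarity f-quadratic 2≢0 κ κ-additive κ-involutive κ-f vertical-point

      -- L 0 (f z) is the line joining the feet (z , 0) and (- z , 0).
      𝒰θ-not-equivalent : ∀ {z w t} → z ≢ 0# → w ≢ z → w ≢ - z →
        t ∈ F → f w - f z ≡ t * θ → ¬ Equivalent 𝒰[ F , θ ] (𝒰 κ)
      𝒰θ-not-equivalent {z} {w} {t} z≢0 w≢z w≢-z t∈F fw-fz≡tθ equivalent =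
        [ w≢z , w≢-z ]′ (planar-fibre f-quadratic planar fw≡fz)
        where
        tangent : ∀ x {s} → s ∈ F → f x - f z ≡ s * θ →
                  TangentAt 𝒰[ F , θ ] (L (- x) (f x - f z)) (affine x (- (f x - f z)))
        tangent x = 𝒰θ-tangent x
        -- This incidence dictates the second parameter: over abscissa `0#` the line `L (- x) b` has
        -- ordinate `f x - b`, which is `f z` for `b = f x - f z`.
        through : ∀ x → affine 0# (f z) ∈ pointsOn (L (- x) (f x - f z))
        through x = affine∈L⁺ (begin
          f z                                ≡⟨ solve 2 (λ u v → v := u :- (u :- v)) refl (f x) (f z) ⟩
          f x - (f x - f z)                  ≡⟨ cong (_- (f x - f z)) (trans (cong f (solve 1 (λ x → con 0ℤ :- x := :- x) refl x)) (even x)) ⟨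
          f (0# + - x) - (f x - f z)         ∎)
        on-secant : ∀ x → f x ≡ f z → affine x (- (f x - f z)) ∈ pointsOn (L 0# (f z))
        on-secant x fx≡fz = affine∈L⁺ (begin
          - (f x - f z)          ≡⟨ solve 2 (λ u v → :- (u :- v) := v :- u) refl (f x) (f z) ⟩
          f z - f x              ≡⟨ cong₂ _-_ fx≡fz (sym fx≡fz) ⟨
          f x - f z              ≡⟨ cong (λ u → f u - f z) (+-identityʳ x) ⟨
          f (x + 0#) - f z       ∎)
        fx-fz≡0θ : ∀ x → f x ≡ f z → f x - f z ≡ 0# * θ
        fx-fz≡0θ x fx≡fz = trans (cong (_- f z) fx≡fz) (trans (-‿inverseʳ (f z)) (sym (zeroˡ θ)))
        feet-differ : affine {K = K} z (- (f z - f z)) ≢ affine (- z) (- (f (- z) - f z))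
        feet-differ eq = z≢0 (x+x≡0⇒x≡0 2≢0 (trans (cong (z +_) (proj₁ (affine-injective eq))) (-‿inverseʳ z)))
        -- The third foot has ordinate `f z - f w`, whereas the secant has ordinate `f w - f z` over
        -- `w`.
        fw≡fz : f w ≡ f z
        fw≡fz = x∙y⁻¹≈ε⇒x≈y (f w) (f z) (x+x≡0⇒x≡0 2≢0 (begin
          f w - f z + (f w - f z)            ≡⟨ solve 2 (λ u v → u :- v :+ (u :- v) := u :- v :- (:- (u :- v))) refl (f w) (f z) ⟩
          f w - f z - (- (f w - f z))        ≡⟨ cong (λ u → f w - f z - u) (trans (affine∈L⁻ third) (cong (λ u → f u - f z) (+-identityʳ w))) ⟩
          f w - f z - (f w - f z)            ≡⟨ -‿inverseʳ _ ⟩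
          0#                                 ∎))
          where
          third : affine w (- (f w - f z)) ∈ pointsOn (L 0# (f z))
          third = feet-collinear planar equivalent (affine 0# (f z))
            (tangent z 0∈F (fx-fz≡0θ z refl)) (tangent (- z) 0∈F (fx-fz≡0θ (- z) (even z))) (tangent w t∈F fw-fz≡tθ)
            (through z) (through (- z)) (through w)
            feet-differ (L 0# (f z)) (on-secant z refl) (on-secant (- z) (even z))

open ≡ using (refl; sym; trans; cong; cong₂)

theorem4p2 : (p n q : ℕ) → Prime p → p ≢ 2 → 1 ℕ.≤ n → q ≡ p ℕ.^ n →
    (K : FiniteField (q ℕ.^ 2)) →
    let open FiniteField K in
    (Fq : Pred Carrier 0ℓ) → IsSubfield K Fq → HasSize Fq q →
    (ξ : Carrier) → ξ ∉ Fq →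
    (P : DembowskiOstrom K) →
    let f = eval K p P
        open Plane K f in
    Planar K f →
    (κ : Carrier → Carrier) →
    (∀ x y → κ (x + y) ≡ κ x + κ y) →
    (∀ x → κ (κ x) ≡ x) →
    (∀ x → κ (f x) ≡ f (κ x)) →
    (∀ x → HasSize (λ y → y + κ y ≡ f (x + κ x)) q) →
    (f₀ f₁ : Carrier → Carrier) →
    (∀ x → f₀ x ∈ Fq) → (∀ x → f₁ x ∈ Fq) →
    (∀ x → f x ≡ f₀ x + f₁ x * ξ) →
    (θ θ₀ θ₁ : Carrier) → θ₀ ∈ Fq → θ₁ ∈ Fq → θ ≡ θ₀ + θ₁ * ξ →
    θ ≢ 0# →
    (∀ c → c ∈ Fq → c ≢ 0# → HasSize (λ x → θ₁ * f₀ x - θ₀ * f₁ x ≡ c) (q ℕ.+ 1)) →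
    HasSize (λ x → θ₁ * f₀ x - θ₀ * f₁ x ≡ 0#) 1 →
    ¬ Equivalent 𝒰[ Fq , θ ] (𝒰 κ)
theorem4p2 p n q p-prime p≢2 1≤n refl K Fq Fq-subfield _ ξ ξ∉Fq P planar κ κ-additive κ-involutive κ-f
  vertical-size f₀ f₁ f₀∈Fq f₁∈Fq f≡ θ θ₀ θ₁ θ₀∈Fq θ₁∈Fq θ≡ θ≢0 size-nonzero size-zero =
  -- The value `1#` stands for any nonzero element of the subfield. For `z` only `0#` has to be
  -- avoided, so it is passed twice.
  let z , γz≡1 , z≢0 , _     = HasSize⇒avoid-two _≟_ 3≤q+1 (size-nonzero 1# 1∈F 1≢0) 0# 0#
      w , γw≡1 , w≢z , w≢-z  = HasSize⇒avoid-two _≟_ 3≤q+1 (size-nonzero 1# 1∈F 1≢0) z (- z)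
      t , t∈Fq , difference≡tθ = functional-fibre θ≢0 (f₀∈Fq w) (f₁∈Fq w) (f₀∈Fq z) (f₁∈Fq z)
                                   (trans γw≡1 (sym γz≡1))
  in 𝒰θ-not-equivalent Fq-subfield f-quadratic anisotropic planar
       (char≢2⇒2≢0 p-prime p≢2 p×1≡0) κ κ-additive κ-involutive κ-f
       (λ x → HasSize⇒inhabited (ℕ.<⇒≤ 2≤q) (vertical-size x))
       z≢0 w≢z w≢-z t∈Fq (trans (cong₂ _-_ (f≡ w) (f≡ z)) difference≡tθ)
  where
  open FiniteField K
  open FiniteFieldProperties K
  open QuadraticMaps K
  open IsSubfield Fq-subfield
  open Coordinates K Fq Fq-subfield ξ ξ∉Fq
  open Functional θ₀∈Fq θ₁∈Fq θ≡
  f = eval K p P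
  open NotEquivalent K f
  open CommutativeRing commutativeRing using (zeroˡ)
  open import Algebra.Properties.Semiring.Mult semiring renaming (_×_ to _⊗_) using ()
  open IntegerCoefficients commutativeRing using (solve; _:=_; _:+_; _:*_; :-_; _:-_; con)

  2≤q : 2 ℕ.≤ p ℕ.^ n
  2≤q = ℕ.≤-trans (ℕ.nonTrivial⇒n>1 p {{prime⇒nonTrivial p-prime}})
    (≡.subst (ℕ._≤ p ℕ.^ n) (ℕ.*-identityʳ p) (ℕ.^-monoʳ-≤ p {{prime⇒nonZero p-prime}} 1≤n))

  3≤q+1 : 3 ℕ.≤ p ℕ.^ n ℕ.+ 1
  3≤q+1 = ℕ.+-monoˡ-≤ 1 2≤q

  p×1≡0 : p ⊗ 1# ≡ 0#
  p×1≡0 = p^k×1≡0⇒p×1≡0 p (n ℕ.* 2) (trans (cong (_⊗ 1#) (sym (ℕ.^-*-assoc p n 2))) order×1≡0)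

  f-quadratic : IsQuadratic f
  f-quadratic = eval-quadratic p-prime p×1≡0 P

  γ : Carrier → Carrier
  γ x = θ₁ * f₀ x - θ₀ * f₁ x

  f∈Fθ⇒γ≡0 : ∀ {x t} → t ∈ Fq → f x ≡ t * θ → γ x ≡ 0#
  f∈Fθ⇒γ≡0 {x} {t} t∈Fq fx≡tθ = trans
    (functional-cong (f₀∈Fq x) (f₁∈Fq x) 0∈F 0∈F t∈Fq
      (trans (sym (f≡ x)) (trans fx≡tθ
        (solve 2 (λ ξ y → y := con 0ℤ :+ con 0ℤ :* ξ :+ y) refl ξ (t * θ)))))
    (solve 2 (λ a b → b :* con 0ℤ :- a :* con 0ℤ := con 0ℤ) refl θ₀ θ₁)

  -- Both `x` and `0#` lie in the fibre of `γ` over `0#`, which has one element.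
  anisotropic : ∀ {x t} → t ∈ Fq → f x ≡ t * θ → x ≡ 0#
  anisotropic t∈Fq fx≡tθ = HasSize1⇒≡ size-zero (f∈Fθ⇒γ≡0 t∈Fq fx≡tθ)
    (f∈Fθ⇒γ≡0 0∈F (trans (quadratic-zero f-quadratic) (sym (zeroˡ θ))))
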